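{- For every positive integer $n$, $$y_{2,2}(n)=C_{2n}+4C_{2n-1}.$$
   Context: $C_m=\frac{1}{m+1}\binom{2m}{m}$ denotes the $m$-th Catalan number. $y_{2,2}(n)$ is the number of lattice paths from $(0,0)$ to $(2n,2n)$, composed only of unit steps to the right $(1,0)$ and up $(0,1)$, that avoid all the points $(2j,2j)$ with $0<j<n$. -}

module Defs where

open import Data.Empty using (⊥)
open import Data.List using (List; []; _∷_; _++_; map; filter; length)
open import Data.List.Membership.Propositional using (_∈_; _∉_)
open import Data.List.Membership.Propositional.Properties
  using (∈-map⁺; ∈-map⁻; ∈-++⁺ˡ; ∈-++⁺ʳ; ∈-filter⁺; ∈-filter⁻)
open import Data.List.Properties using (∷-injectiveʳ)
open import Data.List.Relation.Unary.All as All using ()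
open import Data.List.Relation.Unary.AllPairs as AllPairs using ()
open import Data.List.Relation.Unary.Any using (here; any?)
open import Data.List.Relation.Unary.Unique.Propositional using (Unique)
import Data.List.Relation.Unary.Unique.Propositional.Properties as Unique
open import Data.Nat
  using (ℕ; zero; suc; _+_; _*_; _/_; _<_; s≤s; z≤n)
open import Data.Nat.Combinatorics
  using (_C_; nC1≡n; nCk+nC[k+1]≡[n+1]C[k+1]; k>n⇒nCk≡0)
open import Data.Nat.Divisibility using (_∣_; divides; ∣m+n∣m⇒∣n)
open import Data.Nat.DivMod using (m*[n/m]≡n)
open import Data.Nat.Properties
open import Data.Nat.Tactic.RingSolver using (solve-∀)
open import Data.Product using (_×_; _,_; proj₂)
open import Data.Product.Properties using (≡-dec)
open import Function.Bundles using (_⇔_; mk⇔)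
open import Relation.Binary.Definitions using (DecidableEquality)
open import Relation.Binary.PropositionalEquality
  using (_≡_; refl; sym; trans; cong; cong₂; subst; module ≡-Reasoning)
open import Relation.Nullary.Decidable using (_×-dec_; _→-dec_; ¬?)
open import Relation.Unary using (Decidable)

------------------------------------------------------------------------
-- Catalan numbers

catalan : ℕ → ℕ
catalan m = ((2 * m) C m) / suc m

------------------------------------------------------------------------
-- Lattice paths

Point : Set
Point = ℕ × ℕ

data Step : Set where
  right up : Step

-- A path is given by its sequence of steps; its starting point is
-- supplied separately.
Path : Set
Path = List Step

move : Step → Point → Point
move right (x , y) = suc x , y
move up    (x , y) = x , suc y

endpoint : Point → Path → Point
endpoint p []      = p
endpoint p (s ∷ w) = endpoint (move s p) w

-- Both ends are included.
points : Point → Path → List Point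
points p []      = p ∷ []
points p (s ∷ w) = p ∷ points (move s p) w

origin : Point
origin = 0 , 0

Avoiding : ℕ → Path → Set
Avoiding n w = ∀ {j} → j < n → 0 < j → (2 * j , 2 * j) ∉ points origin w

Admissible : ℕ → Path → Set
Admissible n w = endpoint origin w ≡ (2 * n , 2 * n) × Avoiding n w

_≟ₚ_ : DecidableEquality Point
_≟ₚ_ = ≡-dec _≟_ _≟_

admissible? : ∀ n → Decidable (Admissible n)
admissible? n w =
  (endpoint origin w ≟ₚ (2 * n , 2 * n)) ×-dec
  allUpTo? (λ j → (0 <? j) →-dec ¬? (any? ((2 * j , 2 * j) ≟ₚ_) (points origin w))) n

pathsOfLength : ℕ → List Path
pathsOfLength zero    = [] ∷ []
pathsOfLength (suc k) =
  map (right ∷_) (pathsOfLength k) ++ map (up ∷_) (pathsOfLength k)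

-- Every path from the origin to (2n, 2n) has exactly 4n steps, so no
-- admissible path is missed; see ∈-admissiblePaths.
admissiblePaths : ℕ → List Path
admissiblePaths n = filter (admissible? n) (pathsOfLength (4 * n))

y₂₂ : ℕ → ℕ
y₂₂ n = length (admissiblePaths n)

------------------------------------------------------------------------
-- The division in the definition of catalan is exact

private
  absorb : ∀ n k → suc k * (suc n C suc k) ≡ suc n * (n C k)
  absorb n zero = begin
    1 * (suc n C 1)   ≡⟨ *-identityˡ _ ⟩
    suc n C 1         ≡⟨ nC1≡n (suc n) ⟩
    suc n             ≡⟨ *-identityʳ (suc n) ⟨
    suc n * 1         ∎
    where open ≡-Reasoning
  absorb zero (suc k) = begin
    suc (suc k) * (1 C suc (suc k))  ≡⟨ cong (suc (suc k) *_) (k>n⇒nCk≡0 {1} {suc (suc k)} (s≤s (s≤s z≤n))) ⟩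
    suc (suc k) * 0                  ≡⟨ *-zeroʳ (suc (suc k)) ⟩
    0                                ≡⟨ cong (1 *_) (k>n⇒nCk≡0 {0} {suc k} (s≤s z≤n)) ⟨
    1 * (0 C suc k)                  ∎
    where open ≡-Reasoning
  absorb (suc n) (suc k) = begin
    suc (suc k) * (suc (suc n) C suc (suc k))
      ≡⟨ cong (suc (suc k) *_) (nCk+nC[k+1]≡[n+1]C[k+1] (suc n) (suc k)) ⟨
    suc (suc k) * (a + b)
      ≡⟨ *-distribˡ-+ (suc (suc k)) a b ⟩
    (a + suc k * a) + suc (suc k) * b
      ≡⟨ cong₂ (λ u v → (a + u) + v) (absorb n k) (absorb n (suc k)) ⟩
    (a + suc n * (n C k)) + suc n * (n C suc k)
      ≡⟨ +-assoc a _ _ ⟩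
    a + (suc n * (n C k) + suc n * (n C suc k))
      ≡⟨ cong (a +_) (*-distribˡ-+ (suc n) (n C k) (n C suc k)) ⟨
    a + suc n * (n C k + n C suc k)
      ≡⟨ cong (λ u → a + suc n * u) (nCk+nC[k+1]≡[n+1]C[k+1] n k) ⟩
    suc (suc n) * a ∎
    where
    open ≡-Reasoning
    a = suc n C suc k
    b = suc n C suc (suc k)

  suc∣central : ∀ m → suc m ∣ (2 * m) C m
  suc∣central m = ∣m+n∣m⇒∣n (divides a eq) (divides b (trans (sym lower) (*-comm (suc m) b)))
    where
    open ≡-Reasoning
    a = (2 * m) C m
    b = (2 * m) C suc m

    rearrange : ∀ m a → suc (2 * m) * a ≡ suc m * a + m * a
    rearrange = solve-∀

    lower : suc m * b ≡ m * a
    lower = +-cancelˡ-≡ (suc m * a) _ _ (begin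
      suc m * a + suc m * b             ≡⟨ *-distribˡ-+ (suc m) a b ⟨
      suc m * (a + b)                   ≡⟨ cong (suc m *_) (nCk+nC[k+1]≡[n+1]C[k+1] (2 * m) m) ⟩
      suc m * (suc (2 * m) C suc m)     ≡⟨ absorb (2 * m) m ⟩
      suc (2 * m) * a                   ≡⟨ rearrange m a ⟩
      suc m * a + m * a                 ∎)

    eq : m * a + a ≡ a * suc m
    eq = trans (+-comm (m * a) a) (*-comm (suc m) a)

catalan-exact : ∀ m → suc m * catalan m ≡ (2 * m) C m
catalan-exact m = m*[n/m]≡n (suc∣central m)

------------------------------------------------------------------------
-- admissiblePaths lists every admissible path exactly once

private
  size : Point → ℕ
  size (x , y) = x + y

  size-move : ∀ s p → size (move s p) ≡ suc (size p)
  size-move right (x , y) = refl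
  size-move up    (x , y) = +-suc x y

  size-endpoint : ∀ p w → size (endpoint p w) ≡ size p + length w
  size-endpoint p []      = sym (+-identityʳ (size p))
  size-endpoint p (s ∷ w) = begin
    size (endpoint (move s p) w)  ≡⟨ size-endpoint (move s p) w ⟩
    size (move s p) + length w    ≡⟨ cong (_+ length w) (size-move s p) ⟩
    suc (size p) + length w       ≡⟨ +-suc (size p) (length w) ⟨
    size p + suc (length w)       ∎
    where open ≡-Reasoning

  ∈-pathsOfLength : ∀ w → w ∈ pathsOfLength (length w)
  ∈-pathsOfLength []          = here refl
  ∈-pathsOfLength (right ∷ w) = ∈-++⁺ˡ (∈-map⁺ (right ∷_) (∈-pathsOfLength w))
  ∈-pathsOfLength (up ∷ w)    = ∈-++⁺ʳ _ (∈-map⁺ (up ∷_) (∈-pathsOfLength w))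

  pathsOfLength-unique : ∀ k → Unique (pathsOfLength k)
  pathsOfLength-unique zero    = All.[] AllPairs.∷ AllPairs.[]
  pathsOfLength-unique (suc k) =
    Unique.++⁺ (Unique.map⁺ ∷-injectiveʳ (pathsOfLength-unique k))
               (Unique.map⁺ ∷-injectiveʳ (pathsOfLength-unique k))
               disjoint
    where
    disjoint : ∀ {w} → w ∈ map (right ∷_) (pathsOfLength k) ×
                       w ∈ map (up ∷_) (pathsOfLength k) → ⊥
    disjoint (p , q) with ∈-map⁻ (right ∷_) p | ∈-map⁻ (up ∷_) q
    ... | _ , _ , refl | _ , _ , ()

  admissible-length : ∀ n w → Admissible n w → length w ≡ 4 * n
  admissible-length n w (end , _) = begin
    length w                  ≡⟨ size-endpoint origin w ⟨
    size (endpoint origin w)  ≡⟨ cong size end ⟩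
    2 * n + 2 * n             ≡⟨ *-distribʳ-+ n 2 2 ⟨
    4 * n                     ∎
    where open ≡-Reasoning

admissiblePaths-unique : ∀ n → Unique (admissiblePaths n)
admissiblePaths-unique n =
  Unique.filter⁺ (admissible? n) (pathsOfLength-unique (4 * n))

∈-admissiblePaths : ∀ n w → w ∈ admissiblePaths n ⇔ Admissible n w
∈-admissiblePaths n w = mk⇔
  (λ w∈ → proj₂ (∈-filter⁻ (admissible? n) {xs = pathsOfLength (4 * n)} w∈))
  (λ adm → ∈-filter⁺ (admissible? n)
    (subst (λ k → w ∈ pathsOfLength k) (admissible-length n w adm) (∈-pathsOfLength w))
    adm)

{-# OPTIONS --safe #-}
module Submission where

-- Splitting a path to (2n, 2n) at its first visit to some (2j, 2j), j > 0, gives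
-- Σ_j y(j) B(n - j) = B(n) with B(j) = C(4j, 2j), and this determines y.  Write
-- u₀ and u₁ for the even and odd parts of u = 1/√(1 - 4x) = Σ C(2m, m) x^m, so that
-- B is u₀ read off at even exponents.  Coefficientwise, (1 - 4x) u = √(1 - 4x) shows
-- that 2 (C_{2n} + 4 C_{2n-1}) = 16 u_{2n-1} - u_{2n+1}, i.e. up to the initial term
-- the claimed values are those of -(1 - 16x²) u₁ / 2.  Finally u₀ u₁ is half the odd
-- part of u² = 1/(1 - 4x), that is 2x / (1 - 16x²), so they satisfy the same recurrence.

open import Defs
open import Data.Bool using (true; false)
open import Data.List using ([]; _∷_; _++_; map; filter; length)
open import Data.List.Membership.Propositional using (_∈_; _∉_)
open import Data.List.Properties using (length-++; filter-++; filter-≐; filter-none)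
import Data.List.Relation.Unary.All as All
open import Data.List.Relation.Unary.Any using (here; there; any?)
open import Data.Nat using (ℕ; zero; suc; pred; _+_; _*_; _∸_; _≤_; _<_; z≤n; s≤s; NonZero)
open import Data.Nat.Combinatorics
open import Data.Nat.Divisibility using (divides; _∣?_)
open import Data.Nat.Properties
open import Data.Nat.Tactic.RingSolver using (solve-∀)
open import Data.Product using (_×_; _,_; proj₁; proj₂; ∃)
open import Function using (_∘_)
open import Level using (0ℓ)
open import Relation.Binary.Definitions using (tri<; tri≈; tri>)
open import Relation.Binary.PropositionalEquality
open import Relation.Nullary using (¬_; yes; no; does; contradiction)
open import Relation.Nullary.Decidable using (_×-dec_; _→-dec_; ¬?; dec-true; dec-false)
open import Relation.Unary using (Pred; Decidable; _≐_)
open ≡-Reasoning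

-- Cauchy products

-- Shifting `f` along the recursion stands in for the index n - i of the usual sum, so truncated
-- subtraction never enters.
conv : (ℕ → ℕ) → (ℕ → ℕ) → ℕ → ℕ
conv f g zero    = f 0 * g 0
conv f g (suc n) = f 0 * g (suc n) + conv (f ∘ suc) g n

conv-cong : ∀ {f f′ g g′} n → (∀ i → i ≤ n → f i ≡ f′ i) → (∀ i → g i ≡ g′ i) →
            conv f g n ≡ conv f′ g′ n
conv-cong zero    p q = cong₂ _*_ (p 0 z≤n) (q 0)
conv-cong (suc n) p q = cong₂ _+_ (cong₂ _*_ (p 0 z≤n) (q (suc n)))
  (conv-cong n (λ i i≤n → p (suc i) (s≤s i≤n)) q)

conv-zeroˡ : ∀ {f} g n → (∀ i → i ≤ n → f i ≡ 0) → conv f g n ≡ 0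
conv-zeroˡ g zero    p = cong (_* g 0) (p 0 z≤n)
conv-zeroˡ g (suc n) p = cong₂ _+_ (cong (_* g (suc n)) (p 0 z≤n))
  (conv-zeroˡ g n (λ i i≤n → p (suc i) (s≤s i≤n)))

conv-+ˡ : ∀ f f′ g n → conv (λ i → f i + f′ i) g n ≡ conv f g n + conv f′ g n
conv-+ˡ f f′ g zero    = *-distribʳ-+ (g 0) (f 0) (f′ 0)
conv-+ˡ f f′ g (suc n) = begin
  (f 0 + f′ 0) * g (suc n) + conv (λ i → f (suc i) + f′ (suc i)) g n
    ≡⟨ cong ((f 0 + f′ 0) * g (suc n) +_) (conv-+ˡ (f ∘ suc) (f′ ∘ suc) g n) ⟩
  (f 0 + f′ 0) * g (suc n) + (conv (f ∘ suc) g n + conv (f′ ∘ suc) g n)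
    ≡⟨ rearrange (f 0) (f′ 0) (g (suc n)) _ _ ⟩
  conv f g (suc n) + conv f′ g (suc n) ∎
  where
  rearrange : ∀ a b c d e → (a + b) * c + (d + e) ≡ (a * c + d) + (b * c + e)
  rearrange = solve-∀

conv-*ˡ : ∀ c f g n → conv (λ i → c * f i) g n ≡ c * conv f g n
conv-*ˡ c f g zero    = *-assoc c (f 0) (g 0)
conv-*ˡ c f g (suc n) = trans
  (cong₂ _+_ (*-assoc c (f 0) (g (suc n))) (conv-*ˡ c (f ∘ suc) g n))
  (sym (*-distribˡ-+ c (f 0 * g (suc n)) (conv (f ∘ suc) g n)))

conv-last : ∀ f g n → conv f g (suc n) ≡ conv f (g ∘ suc) n + f (suc n) * g 0
conv-last f g zero    = refl
conv-last f g (suc n) = trans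
  (cong (f 0 * g (suc (suc n)) +_) (conv-last (f ∘ suc) g n))
  (sym (+-assoc (f 0 * g (suc (suc n))) _ _))

conv-comm : ∀ f g n → conv f g n ≡ conv g f n
conv-comm f g zero    = *-comm (f 0) (g 0)
conv-comm f g (suc n) = begin
  f 0 * g (suc n) + conv (f ∘ suc) g n  ≡⟨ cong₂ _+_ (*-comm (f 0) _) (conv-comm (f ∘ suc) g n) ⟩
  g (suc n) * f 0 + conv g (f ∘ suc) n  ≡⟨ +-comm (g (suc n) * f 0) _ ⟩
  conv g (f ∘ suc) n + g (suc n) * f 0  ≡⟨ conv-last g f n ⟨
  conv g f (suc n)                      ∎

-- Needed when a walk already starts at some (2j, 2j) with j > 0: only one first-hit term survives.
conv-single : ∀ f g i j → (∀ k → k ≢ i → f k ≡ 0) → conv f g (i + j) ≡ f i * g j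
conv-single f g zero    zero    p = refl
conv-single f g zero    (suc j) p = trans
  (cong (f 0 * g (suc j) +_) (conv-zeroˡ g j (λ k _ → p (suc k) (λ ()))))
  (+-identityʳ _)
conv-single f g (suc i) j       p = cong₂ _+_
  (cong (_* g (suc (i + j))) (p 0 (λ ())))
  (conv-single (f ∘ suc) g i j (λ k k≢i → p (suc k) (k≢i ∘ suc-injective)))

-- Leibniz rule for the Euler operator x d/dx on generating functions.
conv-leibniz : ∀ f g n →
  conv (λ i → i * f i) g n + conv f (λ i → i * g i) n ≡ n * conv f g n
conv-leibniz f g zero    = *-zeroʳ (f 0)
conv-leibniz f g (suc n) = begin
  conv (λ i → f′ i + i * f′ i) g n + (f 0 * (suc n * g (suc n)) + F)
    ≡⟨ cong (_+ (f 0 * (suc n * g (suc n)) + F)) (conv-+ˡ f′ (λ i → i * f′ i) g n) ⟩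
  (conv f′ g n + E) + (f 0 * (suc n * g (suc n)) + F)
    ≡⟨ rearrange (conv f′ g n) E F (f 0) (suc n) (g (suc n)) ⟩
  suc n * (f 0 * g (suc n)) + (conv f′ g n + (E + F))
    ≡⟨ cong (λ z → suc n * (f 0 * g (suc n)) + (conv f′ g n + z)) (conv-leibniz f′ g n) ⟩
  suc n * (f 0 * g (suc n)) + suc n * conv f′ g n
    ≡⟨ *-distribˡ-+ (suc n) (f 0 * g (suc n)) (conv f′ g n) ⟨
  suc n * conv f g (suc n) ∎
  where
  f′ = f ∘ suc
  E = conv (λ i → i * f′ i) g n
  F = conv f′ (λ i → i * g i) n
  rearrange : ∀ c e d a m b → (c + e) + (a * (m * b) + d) ≡ m * (a * b) + (c + (e + d))
  rearrange = solve-∀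

-- Two indices with an odd sum have opposite parity, in one of two orders. Removing two terms of `f`
-- at a time preserves the parity of the rest.
conv-odd : ∀ f g n → conv f g (suc (2 * n)) ≡
  conv (λ i → f (2 * i)) (λ i → g (suc (2 * i))) n +
  conv (λ i → f (suc (2 * i))) (λ i → g (2 * i)) n
conv-odd f g zero    = refl
conv-odd f g (suc n) = begin
  conv f g (suc (2 * suc n))
    ≡⟨ cong (conv f g ∘ suc) (*-suc 2 n) ⟩
  f 0 * g (suc (suc (suc (2 * n)))) + (f 1 * g (suc (suc (2 * n))) + conv f″ g (suc (2 * n)))
    ≡⟨ cong₂ (λ a b → f 0 * g (suc a) + (f 1 * g a + b)) (*-suc 2 n) (sym (conv-odd f″ g n)) ⟨
  f 0 * g (suc (2 * suc n)) + (f 1 * g (2 * suc n) + (E + O))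
    ≡⟨ rearrange (f 0 * g (suc (2 * suc n))) (f 1 * g (2 * suc n)) E O ⟩
  (f 0 * g (suc (2 * suc n)) + E) + (f 1 * g (2 * suc n) + O)
    ≡⟨ cong₂ (λ a b → (f 0 * g (suc (2 * suc n)) + a) + (f 1 * g (2 * suc n) + b))
         (conv-cong n (λ i _ → cong f (*-suc 2 i)) (λ _ → refl))
         (conv-cong n (λ i _ → cong (f ∘ suc) (*-suc 2 i)) (λ _ → refl)) ⟨
  conv (λ i → f (2 * i)) (λ i → g (suc (2 * i))) (suc n) +
  conv (λ i → f (suc (2 * i))) (λ i → g (2 * i)) (suc n) ∎
  where
  f″ = f ∘ suc ∘ suc
  E = conv (λ i → f″ (2 * i)) (λ i → g (suc (2 * i))) n
  O = conv (λ i → f″ (suc (2 * i))) (λ i → g (2 * i)) n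
  rearrange : ∀ a b c d → a + (b + (c + d)) ≡ (a + c) + (b + d)
  rearrange = solve-∀

-- A series with constant term 1 can be cancelled: once all lower coefficients agree, `conv-last`
-- isolates the top one, multiplied by `g 0`. Hence `below` carries every index up to `n`.
conv-cancelʳ : ∀ f f′ g → g 0 ≡ 1 → (∀ n → conv f g n ≡ conv f′ g n) → ∀ n → f n ≡ f′ n
conv-cancelʳ f f′ g g0≡1 eq n = below n n ≤-refl
  where
  cancel : ∀ n → f n * g 0 ≡ f′ n * g 0 → f n ≡ f′ n
  cancel n p rewrite g0≡1 = trans (sym (*-identityʳ (f n))) (trans p (*-identityʳ (f′ n)))

  below : ∀ n i → i ≤ n → f i ≡ f′ i
  below zero    zero    _   = cancel 0 (eq 0)
  below (suc n) i i≤ with i ≟ suc n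
  ... | no  i≢ = below n i (≤-pred (≤∧≢⇒< i≤ i≢))
  ... | yes refl = cancel (suc n) (+-cancelˡ-≡ (conv f (g ∘ suc) n) _ _ (begin
    conv f (g ∘ suc) n + f (suc n) * g 0    ≡⟨ conv-last f g n ⟨
    conv f g (suc n)                        ≡⟨ eq (suc n) ⟩
    conv f′ g (suc n)                       ≡⟨ conv-last f′ g n ⟩
    conv f′ (g ∘ suc) n + f′ (suc n) * g 0  ≡⟨ cong (_+ f′ (suc n) * g 0) (conv-cong n (below n) (λ _ → refl)) ⟨
    conv f (g ∘ suc) n + f′ (suc n) * g 0   ∎))

-- Central binomial coefficients and Catalan numbers

-- Absorption identity. Pascal's rule splits the binomial; one copy of `a` is set aside so that the
-- induction hypothesis fits both summands.
[1+k]*[1+n]C[1+k] : ∀ n k → suc k * (suc n C suc k) ≡ suc n * (n C k)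
[1+k]*[1+n]C[1+k] n       zero    = trans (*-identityˡ _) (trans (nC1≡n (suc n)) (sym (*-identityʳ (suc n))))
[1+k]*[1+n]C[1+k] zero    (suc k) = trans
  (cong (suc (suc k) *_) (k>n⇒nCk≡0 {1} {suc (suc k)} (s≤s (s≤s z≤n))))
  (trans (*-zeroʳ (suc (suc k))) (sym (cong (1 *_) (k>n⇒nCk≡0 {0} {suc k} (s≤s z≤n)))))
[1+k]*[1+n]C[1+k] (suc n) (suc k) = begin
  suc (suc k) * (suc (suc n) C suc (suc k))
    ≡⟨ cong (suc (suc k) *_) (nCk+nC[k+1]≡[n+1]C[k+1] (suc n) (suc k)) ⟨
  suc (suc k) * (a + b)
    ≡⟨ rearrange k a b ⟩
  a + (suc k * a + suc (suc k) * b)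
    ≡⟨ cong (a +_) (cong₂ _+_ ([1+k]*[1+n]C[1+k] n k) ([1+k]*[1+n]C[1+k] n (suc k))) ⟩
  a + (suc n * (n C k) + suc n * (n C suc k))
    ≡⟨ cong (a +_) (*-distribˡ-+ (suc n) (n C k) (n C suc k)) ⟨
  a + suc n * (n C k + n C suc k)
    ≡⟨ cong (λ u → a + suc n * u) (nCk+nC[k+1]≡[n+1]C[k+1] n k) ⟩
  suc (suc n) * a ∎
  where
  a = suc n C suc k
  b = suc n C suc (suc k)
  rearrange : ∀ k a b → suc (suc k) * (a + b) ≡ a + (suc k * a + suc (suc k) * b)
  rearrange = solve-∀

centralBinomial : ℕ → ℕ
centralBinomial m = (2 * m) C m

-- Absorption in rows 2m + 2 and 2m + 1, joined by the symmetry C(2m + 1, m) = C(2m + 1, m + 1) in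
-- `middle`.
centralBinomial-suc : ∀ m → suc m * centralBinomial (suc m) ≡ (4 * m + 2) * centralBinomial m
centralBinomial-suc m = begin
  suc m * ((2 * suc m) C suc m)          ≡⟨ cong (λ n → suc m * (n C suc m)) (*-suc 2 m) ⟩
  suc m * (suc (suc (2 * m)) C suc m)    ≡⟨ [1+k]*[1+n]C[1+k] (suc (2 * m)) m ⟩
  suc (suc (2 * m)) * (suc (2 * m) C m)  ≡⟨ cong (suc (suc (2 * m)) *_) middle ⟩
  suc (suc (2 * m)) * c                  ≡⟨ rearrange₁ m c ⟩
  2 * (suc m * c)                        ≡⟨ cong (2 *_) ([1+k]*[1+n]C[1+k] (2 * m) m) ⟩
  2 * (suc (2 * m) * centralBinomial m)  ≡⟨ rearrange₂ m (centralBinomial m) ⟩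
  (4 * m + 2) * centralBinomial m        ∎
  where
  c = suc (2 * m) C suc m
  m≤1+2m : m ≤ suc (2 * m)
  m≤1+2m = ≤-trans (m≤m+n m (m + 0)) (n≤1+n (2 * m))
  rearrange₀ : ∀ m → suc (2 * m) ≡ m + suc m
  rearrange₀ = solve-∀
  middle : suc (2 * m) C m ≡ c
  middle = trans (nCk≡nC[n∸k] m≤1+2m)
    (cong (suc (2 * m) C_) (trans (cong (_∸ m) (rearrange₀ m)) (m+n∸m≡n m (suc m))))
  rearrange₁ : ∀ m c → suc (suc (2 * m)) * c ≡ 2 * (suc m * c)
  rearrange₁ = solve-∀
  rearrange₂ : ∀ m c → 2 * (suc (2 * m) * c) ≡ (4 * m + 2) * c
  rearrange₂ = solve-∀

-- (1 - 4x) / √(1 - 4x) = √(1 - 4x), coefficientwise.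
centralBinomial+2*catalan : ∀ m →
  centralBinomial (suc m) + 2 * catalan m ≡ 4 * centralBinomial m
centralBinomial+2*catalan m = *-cancelˡ-≡ _ _ (suc m) (begin
  suc m * (centralBinomial (suc m) + 2 * catalan m)
    ≡⟨ rearrange₁ (suc m) (centralBinomial (suc m)) (catalan m) ⟩
  suc m * centralBinomial (suc m) + 2 * (suc m * catalan m)
    ≡⟨ cong₂ (λ a b → a + 2 * b) (centralBinomial-suc m) (catalan-exact m) ⟩
  (4 * m + 2) * centralBinomial m + 2 * centralBinomial m
    ≡⟨ rearrange₂ m (centralBinomial m) ⟩
  suc m * (4 * centralBinomial m) ∎)
  where
  rearrange₁ : ∀ m a b → m * (a + 2 * b) ≡ m * a + 2 * (m * b)
  rearrange₁ = solve-∀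
  rearrange₂ : ∀ m c → (4 * m + 2) * c + 2 * c ≡ suc m * (4 * c)
  rearrange₂ = solve-∀

-- With θ = x d/dx, `centralBinomial-suc` reads u' = 4θu + 2u. Hence (u²)' = 2uu' = 4θ(u²) + 4u²,
-- whose coefficient at x^m is the claim multiplied by m + 1.
centralBinomial²-suc : ∀ m → conv centralBinomial centralBinomial (suc m) ≡
                             4 * conv centralBinomial centralBinomial m
centralBinomial²-suc m = *-cancelˡ-≡ _ _ (suc m) (begin
  suc m * S (suc m)          ≡⟨ twice (suc m) ⟨
  2 * D (suc m)              ≡⟨ cong (2 *_) D-suc ⟩
  2 * (4 * D m + 2 * S m)    ≡⟨ rearrange₁ (D m) (S m) ⟩
  4 * (2 * D m) + 4 * S m    ≡⟨ cong (λ z → 4 * z + 4 * S m) (twice m) ⟩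
  4 * (m * S m) + 4 * S m    ≡⟨ rearrange₂ m (S m) ⟩
  suc m * (4 * S m)          ∎)
  where
  u = centralBinomial
  θu : ℕ → ℕ
  θu i = i * u i
  S D : ℕ → ℕ
  S = conv u u
  D = conv θu u
  twice : ∀ n → 2 * D n ≡ n * S n
  twice n = begin
    D n + (D n + 0)    ≡⟨ cong (D n +_) (trans (+-identityʳ (D n)) (conv-comm θu u n)) ⟩
    D n + conv u θu n  ≡⟨ conv-leibniz u u n ⟩
    n * S n            ∎
  rearrange₀ : ∀ i a → (4 * i + 2) * a ≡ 4 * (i * a) + 2 * a
  rearrange₀ = solve-∀
  D-suc : D (suc m) ≡ 4 * D m + 2 * S m
  D-suc = begin
    -- The leading term of `D (suc m)` has the factor `θu 0`, which computes to 0.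
    conv (θu ∘ suc) u m
      ≡⟨ conv-cong m (λ i _ → trans (centralBinomial-suc i) (rearrange₀ i (u i))) (λ _ → refl) ⟩
    conv (λ i → 4 * θu i + 2 * u i) u m
      ≡⟨ conv-+ˡ (λ i → 4 * θu i) (λ i → 2 * u i) u m ⟩
    conv (λ i → 4 * θu i) u m + conv (λ i → 2 * u i) u m
      ≡⟨ cong₂ _+_ (conv-*ˡ 4 θu u m) (conv-*ˡ 2 u u m) ⟩
    4 * D m + 2 * S m ∎
  rearrange₁ : ∀ d s → 2 * (4 * d + 2 * s) ≡ 4 * (2 * d) + 4 * s
  rearrange₁ = solve-∀
  rearrange₂ : ∀ m s → 4 * (m * s) + 4 * s ≡ suc m * (4 * s)
  rearrange₂ = solve-∀

-- Even and odd parts of the central binomial series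

evenCentral oddCentral : ℕ → ℕ
evenCentral i = centralBinomial (2 * i)
oddCentral  i = centralBinomial (suc (2 * i))

-- The product of the odd and even parts of 1/√(1 - 4x) is half the odd part of 1/(1 - 4x).
conv-odd-even-suc : ∀ n → conv oddCentral evenCentral (suc n) ≡ 16 * conv oddCentral evenCentral n
conv-odd-even-suc n = *-cancelˡ-≡ _ _ 2 (begin
  2 * W (suc n)              ≡⟨ double (suc n) ⟨
  S (suc (2 * suc n))        ≡⟨ cong (S ∘ suc) (*-suc 2 n) ⟩
  S (suc (suc (suc (2 * n))))  ≡⟨ centralBinomial²-suc (suc (suc (2 * n))) ⟩
  4 * S (suc (suc (2 * n)))  ≡⟨ cong (4 *_) (centralBinomial²-suc (suc (2 * n))) ⟩
  4 * (4 * S (suc (2 * n)))  ≡⟨ cong (λ z → 4 * (4 * z)) (double n) ⟩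
  4 * (4 * (2 * W n))        ≡⟨ rearrange (W n) ⟩
  2 * (16 * W n)             ∎)
  where
  S W : ℕ → ℕ
  S = conv centralBinomial centralBinomial
  W = conv oddCentral evenCentral
  double : ∀ n → S (suc (2 * n)) ≡ 2 * W n
  double n = begin
    S (suc (2 * n))                         ≡⟨ conv-odd centralBinomial centralBinomial n ⟩
    conv evenCentral oddCentral n + W n     ≡⟨ cong (_+ W n) (conv-comm evenCentral oddCentral n) ⟩
    W n + W n                               ≡⟨ cong (W n +_) (+-identityʳ (W n)) ⟨
    2 * W n                                 ∎
  rearrange : ∀ w → 4 * (4 * (2 * w)) ≡ 2 * (16 * w)
  rearrange = solve-∀

-- The claimed value at n = i + 1, with 2n and 2n - 1 in successor form.
catalanSum : ℕ → ℕ
catalanSum i = catalan (suc (suc (2 * i))) + 4 * catalan (suc (2 * i))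

-- `centralBinomial+2*catalan` is used at 2i + 2 and, four times over, at 2i + 1; the weight 4 on
-- the lower Catalan number makes the two fit together.
oddCentral-suc : ∀ i → oddCentral (suc i) + 2 * catalanSum i ≡ 16 * oddCentral i
oddCentral-suc i = begin
  u (suc (2 * suc i)) + 2 * (catalan (suc m) + 4 * catalan m)
    ≡⟨ cong (λ k → u (suc k) + 2 * (catalan (suc m) + 4 * catalan m)) (*-suc 2 i) ⟩
  u (suc (suc m)) + 2 * (catalan (suc m) + 4 * catalan m)
    ≡⟨ rearrange₁ (u (suc (suc m))) (catalan (suc m)) (catalan m) ⟩
  (u (suc (suc m)) + 2 * catalan (suc m)) + 8 * catalan m
    ≡⟨ cong (_+ 8 * catalan m) (centralBinomial+2*catalan (suc m)) ⟩
  4 * u (suc m) + 8 * catalan m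
    ≡⟨ rearrange₂ (u (suc m)) (catalan m) ⟩
  4 * (u (suc m) + 2 * catalan m)
    ≡⟨ cong (4 *_) (centralBinomial+2*catalan m) ⟩
  4 * (4 * u m)
    ≡⟨ *-assoc 4 4 (u m) ⟨
  16 * u m ∎
  where
  u = centralBinomial
  m = suc (2 * i)
  rearrange₁ : ∀ a b c → a + 2 * (b + 4 * c) ≡ (a + 2 * b) + 8 * c
  rearrange₁ = solve-∀
  rearrange₂ : ∀ a c → 4 * a + 8 * c ≡ 4 * (a + 2 * c)
  rearrange₂ = solve-∀

-- Convolve `oddCentral-suc` with `evenCentral`. By `conv-odd-even-suc` the right-hand side is the
-- next coefficient of the same product, so everything but the contribution of `oddCentral 0`
-- cancels. The shifted convolution is added to both sides to avoid subtraction.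
conv-catalanSum : ∀ n → conv catalanSum evenCentral n ≡ evenCentral (suc n)
conv-catalanSum n = *-cancelˡ-≡ _ _ 2 (+-cancelˡ-≡ (conv (oddCentral ∘ suc) e n) _ _ (begin
  conv (oddCentral ∘ suc) e n + 2 * conv catalanSum e n
    ≡⟨ cong (conv (oddCentral ∘ suc) e n +_) (conv-*ˡ 2 catalanSum e n) ⟨
  conv (oddCentral ∘ suc) e n + conv (λ i → 2 * catalanSum i) e n
    ≡⟨ conv-+ˡ (oddCentral ∘ suc) (λ i → 2 * catalanSum i) e n ⟨
  conv (λ i → oddCentral (suc i) + 2 * catalanSum i) e n
    ≡⟨ conv-cong n (λ i _ → oddCentral-suc i) (λ _ → refl) ⟩
  conv (λ i → 16 * oddCentral i) e n
    ≡⟨ conv-*ˡ 16 oddCentral e n ⟩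
  16 * conv oddCentral e n
    ≡⟨ conv-odd-even-suc n ⟨
  -- The 2 is `oddCentral 0`, that is C(2, 1).
  2 * e (suc n) + conv (oddCentral ∘ suc) e n
    ≡⟨ +-comm (2 * e (suc n)) _ ⟩
  conv (oddCentral ∘ suc) e n + 2 * e (suc n) ∎))
  where e = evenCentral

-- Counting walks

length-filter-map : ∀ {P : Pred Path 0ℓ} (P? : Decidable P) (f : Path → Path) ws →
  length (filter P? (map f ws)) ≡ length (filter (P? ∘ f) ws)
length-filter-map P? f []       = refl
length-filter-map P? f (w ∷ ws) with does (P? (f w))
... | true  = cong suc (length-filter-map P? f ws)
... | false = length-filter-map P? f ws

count : {P : Pred Path 0ℓ} → Decidable P → ℕ → ℕ
count P? k = length (filter P? (pathsOfLength k))

module _ {P : Pred Path 0ℓ} (P? : Decidable P) where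

  count-suc : ∀ k → count P? (suc k) ≡ count (P? ∘ (right ∷_)) k + count (P? ∘ (up ∷_)) k
  count-suc k = begin
    length (filter P? (R ++ U))
      ≡⟨ cong length (filter-++ P? R U) ⟩
    length (filter P? R ++ filter P? U)
      ≡⟨ length-++ (filter P? R) ⟩
    length (filter P? R) + length (filter P? U)
      ≡⟨ cong₂ _+_ (length-filter-map P? (right ∷_) (pathsOfLength k))
                   (length-filter-map P? (up ∷_) (pathsOfLength k)) ⟩
    count (P? ∘ (right ∷_)) k + count (P? ∘ (up ∷_)) k ∎
    where
    R = map (right ∷_) (pathsOfLength k)
    U = map (up ∷_) (pathsOfLength k)

  count-none : (∀ w → ¬ P w) → ∀ k → count P? k ≡ 0
  count-none ¬P k = cong length (filter-none P? (All.universal ¬P (pathsOfLength k)))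

  count-[] : P [] → count P? 0 ≡ 1
  count-[] p rewrite dec-true (P? []) p = refl

  count-¬[] : ¬ P [] → count P? 0 ≡ 0
  count-¬[] ¬p rewrite dec-false (P? []) ¬p = refl

count-≐ : {P Q : Pred Path 0ℓ} (P? : Decidable P) (Q? : Decidable Q) → P ≐ Q →
          ∀ k → count P? k ≡ count Q? k
count-≐ P? Q? P≐Q k = cong length (filter-≐ P? Q? P≐Q (pathsOfLength k))

walks : Point → Point → ℕ → ℕ
walks q p = count (λ w → endpoint p w ≟ₚ q)

walks-suc : ∀ q p k → walks q p (suc k) ≡ walks q (move right p) k + walks q (move up p) k
walks-suc q p k = count-suc (λ w → endpoint p w ≟ₚ q) k

endpoint-≥ˣ : ∀ x y w → x ≤ proj₁ (endpoint (x , y) w)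
endpoint-≥ˣ x y []          = ≤-refl
endpoint-≥ˣ x y (right ∷ w) = ≤-trans (n≤1+n x) (endpoint-≥ˣ (suc x) y w)
endpoint-≥ˣ x y (up ∷ w)    = endpoint-≥ˣ x (suc y) w

endpoint-≥ʸ : ∀ x y w → y ≤ proj₂ (endpoint (x , y) w)
endpoint-≥ʸ x y []          = ≤-refl
endpoint-≥ʸ x y (right ∷ w) = endpoint-≥ʸ (suc x) y w
endpoint-≥ʸ x y (up ∷ w)    = ≤-trans (n≤1+n y) (endpoint-≥ʸ x (suc y) w)

-- Splitting by the first step is Pascal's rule. Once a coordinate has its final value, a further
-- step in that direction overshoots for good, so one of the two counts vanishes.
walks-binomial : ∀ x y a b → walks (x + a , y + b) (x , y) (a + b) ≡ (a + b) C a
walks-binomial x y zero    zero    =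
  count-[] (λ w → endpoint (x , y) w ≟ₚ (x + 0 , y + 0))
    (sym (cong₂ _,_ (+-identityʳ x) (+-identityʳ y)))
walks-binomial x y zero    (suc b) = begin
  walks q (x , y) (suc b)
    ≡⟨ walks-suc q (x , y) b ⟩
  walks q (suc x , y) b + walks q (x , suc y) b
    ≡⟨ cong (_+ walks q (x , suc y) b) (count-none (λ w → endpoint (suc x , y) w ≟ₚ q) overshoot b) ⟩
  walks (x + 0 , y + suc b) (x , suc y) b
    ≡⟨ cong (λ y′ → walks (x + 0 , y′) (x , suc y) b) (+-suc y b) ⟩
  walks (x + 0 , suc y + b) (x , suc y) b
    ≡⟨ walks-binomial x (suc y) zero b ⟩
  1 ∎
  where
  q = (x + 0 , y + suc b)
  overshoot : ∀ w → endpoint (suc x , y) w ≢ q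
  overshoot w eq = 1+n≰n
    (subst (suc x ≤_) (trans (cong proj₁ eq) (+-identityʳ x)) (endpoint-≥ˣ (suc x) y w))
walks-binomial x y (suc a) zero    = begin
  walks q (x , y) (suc (a + 0))
    ≡⟨ walks-suc q (x , y) (a + 0) ⟩
  walks q (suc x , y) (a + 0) + walks q (x , suc y) (a + 0)
    ≡⟨ cong (walks q (suc x , y) (a + 0) +_)
         (count-none (λ w → endpoint (x , suc y) w ≟ₚ q) overshoot (a + 0)) ⟩
  walks q (suc x , y) (a + 0) + 0
    ≡⟨ +-identityʳ _ ⟩
  walks (x + suc a , y + 0) (suc x , y) (a + 0)
    ≡⟨ cong (λ x′ → walks (x′ , y + 0) (suc x , y) (a + 0)) (+-suc x a) ⟩
  walks (suc x + a , y + 0) (suc x , y) (a + 0)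
    ≡⟨ walks-binomial (suc x) y a zero ⟩
  (a + 0) C a
    ≡⟨ cong (_C a) (+-identityʳ a) ⟩
  a C a
    ≡⟨ nCn≡1 a ⟩
  1
    ≡⟨ nCn≡1 (suc a) ⟨
  suc a C suc a
    ≡⟨ cong (λ n → suc n C suc a) (+-identityʳ a) ⟨
  suc (a + 0) C suc a ∎
  where
  q = (x + suc a , y + 0)
  overshoot : ∀ w → endpoint (x , suc y) w ≢ q
  overshoot w eq = 1+n≰n
    (subst (suc y ≤_) (trans (cong proj₂ eq) (+-identityʳ y)) (endpoint-≥ʸ x (suc y) w))
walks-binomial x y (suc a) (suc b) = begin
  walks q (x , y) (suc (a + suc b))
    ≡⟨ walks-suc q (x , y) (a + suc b) ⟩
  walks q (suc x , y) (a + suc b) + walks q (x , suc y) (a + suc b)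
    ≡⟨ cong₂ _+_ (cong (λ x′ → walks (x′ , y + suc b) (suc x , y) (a + suc b)) (+-suc x a))
                 (cong₂ (λ y′ n → walks (x + suc a , y′) (x , suc y) n) (+-suc y b) (+-suc a b)) ⟩
  walks (suc x + a , y + suc b) (suc x , y) (a + suc b) +
  walks (x + suc a , suc y + b) (x , suc y) (suc a + b)
    ≡⟨ cong₂ _+_ (walks-binomial (suc x) y a (suc b)) (walks-binomial x (suc y) (suc a) b) ⟩
  (a + suc b) C a + (suc a + b) C suc a
    ≡⟨ cong (λ n → (a + suc b) C a + n C suc a) (+-suc a b) ⟨
  (a + suc b) C a + (a + suc b) C suc a
    ≡⟨ nCk+nC[k+1]≡[n+1]C[k+1] (a + suc b) a ⟩
  suc (a + suc b) C suc a ∎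
  where q = (x + suc a , y + suc b)

-- The points (2i, 2i) and walks avoiding them

diagonal : ℕ → Point
diagonal i = 2 * i , 2 * i

walks-diagonal : ∀ i j → walks (diagonal (i + j)) (diagonal i) (4 * j) ≡ evenCentral j
walks-diagonal i j = begin
  walks (diagonal (i + j)) (diagonal i) (4 * j)
    ≡⟨ cong₂ (λ z k → walks (z , z) (diagonal i) k) (*-distribˡ-+ 2 i j) (rearrange j) ⟩
  walks (2 * i + 2 * j , 2 * i + 2 * j) (diagonal i) (2 * j + 2 * j)
    ≡⟨ walks-binomial (2 * i) (2 * i) (2 * j) (2 * j) ⟩
  (2 * j + 2 * j) C (2 * j)
    ≡⟨ cong (λ n → (2 * j + n) C (2 * j)) (+-identityʳ (2 * j)) ⟨
  evenCentral j ∎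
  where
  rearrange : ∀ j → 4 * j ≡ 2 * j + 2 * j
  rearrange = solve-∀

diagonal-injective : ∀ {i j} → diagonal i ≡ diagonal j → i ≡ j
diagonal-injective eq = *-cancelˡ-≡ _ _ 2 (cong proj₁ eq)

-- `suc i` leaves out the origin, where the paths counted by `y₂₂` start. With no upper bound on
-- `i`, the end point counts as a hit too.
OnDiagonal : Point → Set
OnDiagonal p = ∃ λ i → p ≡ diagonal (suc i)

onDiagonal? : Decidable OnDiagonal
onDiagonal? (x , y) with 2 ∣? x | x ≟ y
... | no ¬2∣x | _ = no λ { (i , eq) →
  ¬2∣x (divides (suc i) (trans (cong proj₁ eq) (*-comm 2 (suc i)))) }
... | _ | no x≢y  = no λ { (i , eq) → x≢y (trans (cong proj₁ eq) (sym (cong proj₂ eq))) }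
... | yes (divides zero    refl) | yes refl = no λ { (i , ()) }
... | yes (divides (suc i) eq)   | yes refl = yes (i , cong₂ _,_ eq′ eq′)
  where eq′ = trans eq (*-comm (suc i) 2)

-- The start is arbitrary to allow induction on the first step. At `origin` this and the next two
-- declarations unfold to their counterparts for `y₂₂`.
AvoidingFrom : Point → ℕ → Path → Set
AvoidingFrom p n w = ∀ {j} → j < n → 0 < j → diagonal j ∉ points p w

AdmissibleFrom : Point → ℕ → Path → Set
AdmissibleFrom p n w = endpoint p w ≡ diagonal n × AvoidingFrom p n w

admissibleFrom? : ∀ p n → Decidable (AdmissibleFrom p n)
admissibleFrom? p n w =
  (endpoint p w ≟ₚ diagonal n) ×-dec
  allUpTo? (λ j → (0 <? j) →-dec ¬? (any? (diagonal j ≟ₚ_) (points p w))) n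

avoidingWalks : ℕ → Point → ℕ → ℕ
avoidingWalks n p = count (admissibleFrom? p n)

start∈points : ∀ p w → p ∈ points p w
start∈points p []      = here refl
start∈points p (s ∷ w) = here refl

-- The start is itself no forbidden point, so dropping it from the list of visited points does not
-- affect avoidance.
avoidingWalks-suc : ∀ n p → ¬ OnDiagonal p → ∀ k → avoidingWalks n p (suc k) ≡
  avoidingWalks n (move right p) k + avoidingWalks n (move up p) k
avoidingWalks-suc n p p∉ k = trans (count-suc (admissibleFrom? p n) k)
  (cong₂ _+_ (count-≐ _ _ (first right) k) (count-≐ _ _ (first up) k))
  where
  first : ∀ s → AdmissibleFrom p n ∘ (s ∷_) ≐ AdmissibleFrom (move s p) n
  first s = (λ { (end , avoid) → end , λ j<n 0<j → avoid j<n 0<j ∘ there })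
          , (λ { (end , avoid) → end , λ { {suc j} j<n 0<j (here eq)  → p∉ (j , sym eq)
                                         ; {suc j} j<n 0<j (there j∈) → avoid j<n 0<j j∈ } })

avoidingWalks-blocked : ∀ {i n} → suc i < n → ∀ k → avoidingWalks n (diagonal (suc i)) k ≡ 0
avoidingWalks-blocked {i} {n} i<n = count-none (admissibleFrom? (diagonal (suc i)) n)
  (λ w adm → proj₂ adm i<n (s≤s z≤n) (start∈points (diagonal (suc i)) w))

avoidingWalks-[] : ∀ n p → p ≢ diagonal n → avoidingWalks n p 0 ≡ 0
avoidingWalks-[] n p p≢ = count-¬[] (admissibleFrom? p n) (p≢ ∘ proj₁)

avoidingWalks-self : ∀ n → avoidingWalks n (diagonal n) 0 ≡ 1
avoidingWalks-self n = count-[] (admissibleFrom? (diagonal n) n)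
  (refl , λ { j<n _ (here eq) → <⇒≢ j<n (diagonal-injective eq) })

-- First-hit decomposition and the recurrence for `y₂₂`

height : Point → ℕ
height (x , y) = x + y

height-move : ∀ s p → height (move s p) ≡ suc (height p)
height-move right (x , y) = refl
height-move up    (x , y) = +-suc x y

height-diagonal : ∀ i → height (diagonal i) ≡ 4 * i
height-diagonal i = sym (*-distribʳ-+ i 2 2)

-- Walks whose length is what remains to be travelled to (2n, 2n); once this
-- point is out of reach, the truncated length 0 leaves only the empty walk,
-- which misses it unless p is (2n, 2n) itself.
remainingWalks : Point → ℕ → ℕ
remainingWalks p n = avoidingWalks n p (4 * n ∸ height p)

remainingWalks-move : ∀ p → ¬ OnDiagonal p → ∀ i → remainingWalks p (suc i) ≡
  remainingWalks (move right p) (suc i) + remainingWalks (move up p) (suc i)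
remainingWalks-move p p∉ i with 4 * suc i ∸ height p in eq
... | suc k = trans (avoidingWalks-suc (suc i) p p∉ k) (sym (cong₂ _+_
    (cong (avoidingWalks (suc i) (move right p)) (shorter right))
    (cong (avoidingWalks (suc i) (move up p)) (shorter up))))
  where
  shorter : ∀ s → 4 * suc i ∸ height (move s p) ≡ k
  shorter s = begin
    4 * suc i ∸ height (move s p)  ≡⟨ cong (4 * suc i ∸_) (height-move s p) ⟩
    4 * suc i ∸ suc (height p)     ≡⟨ pred[m∸n]≡m∸[1+n] (4 * suc i) (height p) ⟨
    pred (4 * suc i ∸ height p)    ≡⟨ cong pred eq ⟩
    k                              ∎
-- The target is no higher than `p`, so all three counts concern the empty walk. It fails from `p`,
-- which is off the diagonal, and from both successors, which lie above the target.
... | zero = trans (avoidingWalks-[] (suc i) p (λ p≡ → p∉ (i , p≡)))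
    (sym (cong₂ _+_ (beyond right) (beyond up)))
  where
  4i<height : ∀ s → 4 * suc i < height (move s p)
  4i<height s = subst (4 * suc i <_) (sym (height-move s p)) (s≤s (m∸n≡0⇒m≤n eq))
  beyond : ∀ s → remainingWalks (move s p) (suc i) ≡ 0
  beyond s = trans
    (cong (avoidingWalks (suc i) (move s p)) (m≤n⇒m∸n≡0 (<⇒≤ (4i<height s))))
    (avoidingWalks-[] (suc i) (move s p) (λ eq′ → <⇒≢ (4i<height s)
      (trans (sym (height-diagonal (suc i))) (sym (cong height eq′)))))

-- If i < k, the start is itself forbidden. If k < i, the target lies behind the start and the
-- truncated length 0 leaves an empty walk that misses it.
remainingWalks-diagonal : ∀ i k → k ≢ i → remainingWalks (diagonal (suc i)) (suc k) ≡ 0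
remainingWalks-diagonal i k k≢i with <-cmp i k
... | tri< i<k _ _ = avoidingWalks-blocked (s≤s i<k) (4 * suc k ∸ height (diagonal (suc i)))
... | tri≈ _ i≡k _ = contradiction (sym i≡k) k≢i
... | tri> _ _ k<i = trans
  (cong (avoidingWalks (suc k) (diagonal (suc i)))
    (m≤n⇒m∸n≡0 (subst (4 * suc k ≤_) (sym (height-diagonal (suc i)))
      (*-monoʳ-≤ 4 (s≤s (<⇒≤ k<i))))))
  (avoidingWalks-[] (suc k) (diagonal (suc i)) (λ eq → k≢i (suc-injective (sym (diagonal-injective eq)))))

remainingWalks-self : ∀ n → remainingWalks (diagonal n) n ≡ 1
remainingWalks-self n = trans
  (cong (avoidingWalks n (diagonal n)) (trans (cong (4 * n ∸_) (height-diagonal n)) (n∸n≡0 (4 * n))))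
  (avoidingWalks-self n)

-- Every walk to (2n, 2n) is split at the first point (2j, 2j), j > 0, that it visits.
walks-firstHit : ∀ n k p → height p + k ≡ 4 * suc n →
  walks (diagonal (suc n)) p k ≡ conv (remainingWalks p ∘ suc) evenCentral n
walks-firstHit n k p len with onDiagonal? p
-- The start is the first hit: the sum collapses to one term, an unrestricted walk from there to the
-- end.
walks-firstHit n k _ len | yes (i , refl) with m≤n⇒∃[o]m+o≡n i≤n
  where
  i≤n : i ≤ n
  i≤n = ≤-pred (*-cancelˡ-≤ 4 (≤-trans (≤-reflexive (sym (height-diagonal (suc i))))
    (m+n≤o⇒m≤o _ (≤-reflexive len))))
... | j , refl = begin
  walks (diagonal (suc (i + j))) (diagonal (suc i)) k
    ≡⟨ cong (walks (diagonal (suc (i + j))) (diagonal (suc i))) k≡4j ⟩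
  walks (diagonal (suc i + j)) (diagonal (suc i)) (4 * j)
    ≡⟨ walks-diagonal (suc i) j ⟩
  evenCentral j
    ≡⟨ *-identityˡ (evenCentral j) ⟨
  1 * evenCentral j
    ≡⟨ cong (_* evenCentral j) (remainingWalks-self (suc i)) ⟨
  remainingWalks (diagonal (suc i)) (suc i) * evenCentral j
    ≡⟨ conv-single (remainingWalks (diagonal (suc i)) ∘ suc) evenCentral i j (remainingWalks-diagonal i) ⟨
  conv (remainingWalks (diagonal (suc i)) ∘ suc) evenCentral (i + j) ∎
  where
  k≡4j : k ≡ 4 * j
  k≡4j = +-cancelˡ-≡ (4 * suc i) k (4 * j) (begin
    4 * suc i + k                    ≡⟨ cong (_+ k) (height-diagonal (suc i)) ⟨
    height (diagonal (suc i)) + k    ≡⟨ len ⟩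
    4 * (suc i + j)                  ≡⟨ *-distribˡ-+ 4 (suc i) j ⟩
    4 * suc i + 4 * j                ∎)
-- Here `p` already has the height of the end point, so every term has truncated length 0 and counts
-- an empty walk from a point off the diagonal.
walks-firstHit n zero p len | no p∉ = trans
  (count-¬[] (λ w → endpoint p w ≟ₚ diagonal (suc n)) (λ eq → p∉ (n , eq)))
  (sym (conv-zeroˡ evenCentral n (λ i i≤n → trans
    (cong (avoidingWalks (suc i) p) (m≤n⇒m∸n≡0
      (subst (4 * suc i ≤_) (trans (sym len) (+-identityʳ (height p))) (*-monoʳ-≤ 4 (s≤s i≤n)))))
    (avoidingWalks-[] (suc i) p (λ eq → p∉ (i , eq))))))
-- The first hit comes after the first step, so both sides split over the two possible first steps.
walks-firstHit n (suc k) p len | no p∉ = begin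
  walks q p (suc k)
    ≡⟨ walks-suc q p k ⟩
  walks q (move right p) k + walks q (move up p) k
    ≡⟨ cong₂ _+_ (walks-firstHit n k (move right p) (len′ right))
                 (walks-firstHit n k (move up p) (len′ up)) ⟩
  conv (remainingWalks (move right p) ∘ suc) evenCentral n +
  conv (remainingWalks (move up p) ∘ suc) evenCentral n
    ≡⟨ conv-+ˡ (remainingWalks (move right p) ∘ suc) (remainingWalks (move up p) ∘ suc) evenCentral n ⟨
  conv (λ i → remainingWalks (move right p) (suc i) + remainingWalks (move up p) (suc i))
       evenCentral n
    ≡⟨ conv-cong n (λ i _ → remainingWalks-move p p∉ i) (λ _ → refl) ⟨
  conv (remainingWalks p ∘ suc) evenCentral n ∎
  where
  q = diagonal (suc n)
  len′ : ∀ s → height (move s p) + k ≡ 4 * suc n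
  len′ s = trans (cong (_+ k) (height-move s p)) (trans (sym (+-suc (height p) k)) len)

conv-y₂₂ : ∀ n → conv (y₂₂ ∘ suc) evenCentral n ≡ evenCentral (suc n)
conv-y₂₂ n = begin
  -- `remainingWalks origin` is `y₂₂` by computation, the origin having height 0.
  conv (remainingWalks origin ∘ suc) evenCentral n  ≡⟨ walks-firstHit n (4 * suc n) origin refl ⟨
  walks (diagonal (suc n)) origin (4 * suc n)       ≡⟨ walks-diagonal 0 (suc n) ⟩
  evenCentral (suc n)                               ∎

theorem19 : (n : ℕ) → .{{_ : NonZero n}} → y₂₂ n ≡ catalan (2 * n) + 4 * catalan (2 * n ∸ 1)
theorem19 (suc n) = begin
  -- Both sequences have the same product with `evenCentral`, whose constant term C(0, 0) computes
  -- to 1.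
  y₂₂ (suc n)   ≡⟨ conv-cancelʳ (y₂₂ ∘ suc) catalanSum evenCentral refl
                     (λ k → trans (conv-y₂₂ k) (sym (conv-catalanSum k))) n ⟩
  catalanSum n  ≡⟨ cong (λ m → catalan m + 4 * catalan (m ∸ 1)) (*-suc 2 n) ⟨
  catalan (2 * suc n) + 4 * catalan (2 * suc n ∸ 1) ∎
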